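{- Let $T$ be a monoid, $M$ a $T$-graded monad on $\mathbf{Set}$ and $\mathcal{L}=(\Theta,\mathcal{O},\Lambda)$ a graded coalgebraic modal logic for $M$ with truth-value set $\Omega$. Then $\mathcal{L}$ is invariant with respect to behavioural equivalence: whenever states $x\in X$ and $y\in Y$ of graded $M$-coalgebras $(X,\gamma)$ and $(Y,\delta)$ are behaviourally equivalent, they are logically equivalent, i.e. $[\![\phi]\!]_\gamma(x)=[\![\phi]\!]_\delta(y)$ for all formulae $\phi$ of $\mathcal{L}$.
   Context: A $T$-graded monad $M$ on $\mathbf{Set}$, for a monoid $(T,\cdot,e)$, consists of endofunctors $M_t$ ($t\in T$) and natural transformations $\mu^{s,t}\colon M_sM_t\to M_{s\cdot t}$, $\eta\colon\mathrm{Id}\to M_e$ such that $\mu^{r,s\cdot t}\circ M_r\mu^{s,t}=\mu^{r\cdot s,t}\circ\mu^{r,s}M_t$ and $\mu^{t,e}\circ M_t\eta=\mathrm{id}=\mu^{e,t}\circ\eta M_t$. A graded $M$-coalgebra is a set $X$ with maps $\gamma_t\colon X\to M_tX$ such that $\gamma_e=\eta_X$ and $\gamma_{s\cdot t}=\mu^{s,t}_X\circ M_s\gamma_t\circ\gamma_s$. A homomorphism $h\colon(X,\gamma)\to(Y,\delta)$ is a map with $M_th\circ\gamma_t=\delta_t\circ h$ for all $t$. States $x\in X$, $y\in Y$ are behaviourally equivalent if there are a graded $M$-coalgebra $(Z,\xi)$ and homomorphisms $g\colon(X,\gamma)\to(Z,\xi)$, $h\colon(Y,\delta)\to(Z,\xi)$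 with $g(x)=h(y)$. A graded coalgebraic modal logic $\mathcal{L}=(\Theta,\mathcal{O},\Lambda)$ consists of a set $\Theta$ of constants, a set $\mathcal{O}$ of propositional operators $p$ with finite arities $\mathrm{ar}(p)\in\mathbb{N}$, and a set $\Lambda$ of (unary) modal operators $\lambda$ with depths $\mathsf{d}(\lambda)\in T$. Formulae are generated by $\phi::=\theta\mid p(\phi_1,\dots,\phi_{\mathrm{ar}(p)})\mid\lambda\phi$. The semantics is given by a set $\Omega$ of truth values, elements $\hat\theta\colon1\to\Omega$, maps $[\![p]\!]\colon\Omega^{\mathrm{ar}(p)}\to\Omega$ and maps $[\![\lambda]\!]\colon M_{\mathsf{d}(\lambda)}\Omega\to\Omega$. For a graded coalgebra $(X,\gamma)$, the map $[\![\phi]\!]_\gamma\colon X\to\Omega$ is defined by: $[\![\theta]\!]_\gamma$ is constant with value $\hat\theta$; $[\![p(\phi_1,\dots,\phi_n)]\!]_\gamma=[\![p]\!]\circ\langle[\![\phi_1]\!]_\gamma,\dots,[\![\phi_n]\!]_\gamma\rangle$; $[\![\lambda\phi]\!]_\gamma=[\![\lambda]\!]\circ M_{\mathsf{d}(\lambda)}[\![\phi]\!]_\gamma\circ\gamma_{\mathsf{d}(\lambda)}$. -}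

module Defs where

open import Level using (Level; _⊔_; suc)
open import Algebra.Core using (Op₂)
open import Algebra.Structures using (IsMonoid)
open import Data.Nat.Base using (ℕ)
open import Data.Product.Base using (Σ-syntax)
open import Data.Vec.Base using (Vec; []; _∷_)
open import Function.Base using (id; _∘_)
open import Relation.Binary.PropositionalEquality using (_≡_; _≗_; subst)

private
  variable
    t ℓ θ o l : Level

-- Set is the category of types in Set ℓ and functions, with functions
-- identified when they are pointwise equal (_≗_).  Function extensionality is
-- not available, so that an endofunctor is well defined on such morphisms
-- has to be stated: this is map-cong.

record Endofunctor (ℓ : Level) : Set (suc ℓ) where
  field
    obj      : Set ℓ → Set ℓ
    map      : {A B : Set ℓ} → (A → B) → obj A → obj B
    map-cong : {A B : Set ℓ} {f g : A → B} → f ≗ g → map f ≗ map g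
    map-id   : {A : Set ℓ} → map {A} id ≗ id
    map-∘    : {A B C : Set ℓ} (g : B → C) (f : A → B) →
               map (g ∘ f) ≗ map g ∘ map f

-- The grades form a monoid with respect to propositional equality.  The two
-- sides of each graded monad law have propositionally but not definitionally
-- equal grades, hence the transports along the monoid laws.

record GradedMonad {T : Set t} {_·_ : Op₂ T} {e : T}
                   (isMonoid : IsMonoid _≡_ _·_ e) (ℓ : Level) :
                   Set (t ⊔ suc ℓ) where
  private module T = IsMonoid isMonoid

  field
    functor : T → Endofunctor ℓ

  M : T → Set ℓ → Set ℓ
  M s = Endofunctor.obj (functor s)

  M₁ : (s : T) {A B : Set ℓ} → (A → B) → M s A → M s B
  M₁ s = Endofunctor.map (functor s)

  field
    η : (A : Set ℓ) → A → M e A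
    μ : (r s : T) (A : Set ℓ) → M r (M s A) → M (r · s) A

    η-natural : {A B : Set ℓ} (f : A → B) →
                M₁ e f ∘ η A ≗ η B ∘ f
    μ-natural : (r s : T) {A B : Set ℓ} (f : A → B) →
                M₁ (r · s) f ∘ μ r s A ≗ μ r s B ∘ M₁ r (M₁ s f)

    μ-assoc     : (r s u : T) (A : Set ℓ) →
                  μ r (s · u) A ∘ M₁ r (μ s u A) ≗
                  subst (λ v → M v A) (T.assoc r s u) ∘
                    μ (r · s) u A ∘ μ r s (M u A)
    μ-identityʳ : (s : T) (A : Set ℓ) →
                  subst (λ v → M v A) (T.identityʳ s) ∘
                    μ s e A ∘ M₁ s (η A) ≗ id
    μ-identityˡ : (s : T) (A : Set ℓ) →
                  subst (λ v → M v A) (T.identityˡ s) ∘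
                    μ e s A ∘ η (M s A) ≗ id

module _ {T : Set t} {_·_ : Op₂ T} {e : T} {isMonoid : IsMonoid _≡_ _·_ e}
         (𝕄 : GradedMonad isMonoid ℓ) where
  open GradedMonad 𝕄

  record Coalgebra : Set (t ⊔ suc ℓ) where
    field
      Carrier : Set ℓ
      γ       : (s : T) → Carrier → M s Carrier
      γ-unit  : γ e ≗ η Carrier
      γ-mult  : (r s : T) → γ (r · s) ≗ μ r s Carrier ∘ M₁ r (γ s) ∘ γ r

  open Coalgebra

  record Hom (X Y : Coalgebra) : Set (t ⊔ ℓ) where
    field
      fun      : Carrier X → Carrier Y
      commutes : (s : T) → M₁ s fun ∘ γ X s ≗ γ Y s ∘ fun

  open Hom

  BehaviourallyEquivalent : (X Y : Coalgebra) → Carrier X → Carrier Y →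
                            Set (t ⊔ suc ℓ)
  BehaviourallyEquivalent X Y x y =
    Σ[ Z ∈ Coalgebra ] Σ[ g ∈ Hom X Z ] Σ[ h ∈ Hom Y Z ] fun g x ≡ fun h y

  record Logic (θ o l : Level) : Set (t ⊔ suc (ℓ ⊔ θ ⊔ o ⊔ l)) where
    field
      Θ     : Set θ
      𝒪     : Set o
      arity : 𝒪 → ℕ
      Λ     : Set l
      depth : Λ → T

      Ω     : Set ℓ
      ⟦_⟧ᶜ  : Θ → Ω
      ⟦_⟧ᵖ  : (p : 𝒪) → Vec Ω (arity p) → Ω
      ⟦_⟧ᵐ  : (λ′ : Λ) → M (depth λ′) Ω → Ω

module _ {T : Set t} {_·_ : Op₂ T} {e : T} {isMonoid : IsMonoid _≡_ _·_ e}
         {𝕄 : GradedMonad isMonoid ℓ} (𝓛 : Logic 𝕄 θ o l) where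
  open GradedMonad 𝕄
  open Coalgebra
  open Logic 𝓛

  data Formula : Set (θ ⊔ o ⊔ l) where
    const : Θ → Formula
    prop  : (p : 𝒪) → Vec Formula (arity p) → Formula
    modal : Λ → Formula → Formula

  -- ⟦ φs ⟧* is the tupling ⟨⟦φ₁⟧,…,⟦φₙ⟧⟩; it is spelled out instead of using
  -- Vec.map so that the recursion is visibly structural.
  mutual
    ⟦_⟧ : Formula → (X : Coalgebra 𝕄) → Carrier X → Ω
    ⟦ const c ⟧    X x = ⟦ c ⟧ᶜ
    ⟦ prop p φs ⟧  X x = ⟦ p ⟧ᵖ (⟦ φs ⟧* X x)
    ⟦ modal λ′ φ ⟧ X x = ⟦ λ′ ⟧ᵐ (M₁ (depth λ′) (⟦ φ ⟧ X) (γ X (depth λ′) x))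

    ⟦_⟧* : ∀ {n} → Vec Formula n → (X : Coalgebra 𝕄) → Carrier X → Vec Ω n
    ⟦ [] ⟧*     X x = []
    ⟦ φ ∷ φs ⟧* X x = ⟦ φ ⟧ X x ∷ ⟦ φs ⟧* X x

  LogicallyEquivalent : (X Y : Coalgebra 𝕄) → Carrier X → Carrier Y →
                        Set (ℓ ⊔ θ ⊔ o ⊔ l)
  LogicallyEquivalent X Y x y = (φ : Formula) → ⟦ φ ⟧ X x ≡ ⟦ φ ⟧ Y y

{-# OPTIONS --safe #-}

-- Truth values are preserved along coalgebra homomorphisms, by induction on
-- formulae, so behaviourally equivalent states both inherit the truth values
-- of their common image.
module Submission where

open import Defs
open import Level using (Level)
open import Algebra.Core using (Op₂)
open import Algebra.Structures using (IsMonoid)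
open import Data.Product.Base using (_,_)
open import Data.Vec.Base using (Vec; []; _∷_)
open import Function.Base using (_∘_)
open import Relation.Binary.PropositionalEquality
  using (_≡_; _≗_; refl; cong; cong₂; module ≡-Reasoning)

-- Evaluation at `X` factors through any homomorphism `X → Z` as evaluation at `Z`; this is
-- `⟦⟧-hom`. The crux is the modal case: functoriality splits the lifted composite, and the
-- homomorphism square trades `M₁ d fun ∘ γ X d` for `γ Z d ∘ fun`. Applying this to both legs of
-- the cospan gives invariance.

module _ {t ℓ θ o l : Level} {T : Set t} {_·_ : Op₂ T} {e : T}
         {isMonoid : IsMonoid _≡_ _·_ e} {𝕄 : GradedMonad isMonoid ℓ}
         (𝓛 : Logic 𝕄 θ o l) {X Z : Coalgebra 𝕄} (f : Hom 𝕄 X Z) where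
  open GradedMonad 𝕄
  open Coalgebra
  open Logic 𝓛
  open Hom f

  mutual
    ⟦⟧-hom : (φ : Formula 𝓛) → ⟦_⟧ 𝓛 φ X ≗ ⟦_⟧ 𝓛 φ Z ∘ fun
    ⟦⟧-hom (const c)    x = refl
    ⟦⟧-hom (prop p φs)  x = cong ⟦ p ⟧ᵖ (⟦⟧*-hom φs x)
    ⟦⟧-hom (modal λ′ φ) x = cong ⟦ λ′ ⟧ᵐ (begin
      M₁ d (⟦_⟧ 𝓛 φ X) (γ X d x)
        -- The induction hypothesis is a pointwise equality, so it passes under the functor by
        -- `map-cong` rather than `cong`.
        ≡⟨ map-cong (⟦⟧-hom φ) (γ X d x) ⟩
      M₁ d (⟦_⟧ 𝓛 φ Z ∘ fun) (γ X d x)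
        ≡⟨ map-∘ (⟦_⟧ 𝓛 φ Z) fun (γ X d x) ⟩
      M₁ d (⟦_⟧ 𝓛 φ Z) (M₁ d fun (γ X d x))
        ≡⟨ cong (M₁ d (⟦_⟧ 𝓛 φ Z)) (commutes d x) ⟩
      M₁ d (⟦_⟧ 𝓛 φ Z) (γ Z d (fun x)) ∎)
      where
      open ≡-Reasoning
      d = depth λ′
      open Endofunctor (functor d) using (map-cong; map-∘)

    -- Follows the recursion of `⟦_⟧*`, which keeps the induction through operator arguments
    -- structural.
    ⟦⟧*-hom : ∀ {n} (φs : Vec (Formula 𝓛) n) →
              ⟦_⟧* 𝓛 φs X ≗ ⟦_⟧* 𝓛 φs Z ∘ fun
    ⟦⟧*-hom []       x = refl
    ⟦⟧*-hom (φ ∷ φs) x = cong₂ _∷_ (⟦⟧-hom φ x) (⟦⟧*-hom φs x)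

theorem5p3 : {t ℓ θ o l : Level} {T : Set t} {_·_ : Op₂ T} {e : T}
    (isMonoid : IsMonoid _≡_ _·_ e)
    (𝕄 : GradedMonad isMonoid ℓ)
    (𝓛 : Logic 𝕄 θ o l)
    (X Y : Coalgebra 𝕄) (x : Coalgebra.Carrier X) (y : Coalgebra.Carrier Y) →
    BehaviourallyEquivalent 𝕄 X Y x y → LogicallyEquivalent 𝓛 X Y x y
theorem5p3 isMonoid 𝕄 𝓛 X Y x y (Z , g , h , gx≡hy) φ = begin
  ⟦_⟧ 𝓛 φ X x         ≡⟨ ⟦⟧-hom 𝓛 g φ x ⟩
  ⟦_⟧ 𝓛 φ Z (fun g x) ≡⟨ cong (⟦_⟧ 𝓛 φ Z) gx≡hy ⟩
  ⟦_⟧ 𝓛 φ Z (fun h y) ≡⟨ ⟦⟧-hom 𝓛 h φ y ⟨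
  ⟦_⟧ 𝓛 φ Y y         ∎
  where
  open ≡-Reasoning
  open Hom
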